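{- The typical (expected) maximal effective row $r$ of a switch table for a sequence of $k$ permutations of degree $n$ chosen uniformly and independently at random with replacement from $\mathrm{Sym}(n)$ is at most $1+\frac{2k}{n}$. In particular, whenever the degree is at least twice the order, i.e. $n\ge 2k$, the typical maximal effective row $r$ is at most two.
   Context: For a sequence $G$ of permutations of $\{1,\dots,n\}$, the entry in row $i$ and column $j$ of a switch table for $G$ is non-trivial if and only if $j>i$ and there is a $\pi$ in $G$ with $\pi(t)=t$ for all $t<i$ and $\pi(j)=i$. Row $i$ is effective if it contains a non-trivial entry, and $r$ is the largest index of an effective row. The expected value is $\mathbb{E}[r]=\sum_{i=1}^{n} i\cdot\mathbb{P}(r=i)$ (sequences without any effective row contribute $0$). -}

module Defs where

open import Data.Fin.Base using (Fin; zero; suc; toℕ; punchIn; _<_)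
open import Data.Fin.Permutation using (Permutation′; _⟨$⟩ʳ_; _≈_; id; insert; remove; insert-punchIn; insert-remove)
open import Data.Fin.Properties using (_≟_; _<?_; any?; all?; punchIn-injective)
open import Data.Integer.Base using (+_)
open import Data.List.Base using (List; []; _∷_; length; map; filter; allFin; cartesianProductWith)
open import Data.List.Extrema.Nat using (max)
open import Data.List.Membership.Propositional.Properties using (∈-allFin)
open import Data.List.Properties using (length-map; length-++; length-tabulate)
open import Data.List.Relation.Unary.Any using (here)
import Data.List.Relation.Unary.Any.Properties as Any
import Data.List.Relation.Unary.Enumerates.Setoid as Enumerates
import Data.List.Relation.Unary.Unique.Propositional.Properties as Unique≡
import Data.List.Relation.Unary.Unique.Setoid as UniqueSetoid
import Data.List.Relation.Unary.Unique.Setoid.Properties as UniqueProperties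
open import Data.List.Relation.Unary.All using ([])
open import Data.List.Relation.Unary.AllPairs using ([]; _∷_)
open import Data.Nat.Base using (ℕ; zero; suc; _+_; _*_; _^_; _!; NonZero)
import Data.Nat.Properties as ℕ
open import Data.Product.Base using (∃; _×_; _,_)
open import Data.Rational.Base as ℚ using (ℚ; _/_)
import Data.Rational.Properties as ℚ
open import Data.Vec.Base using (Vec; []; _∷_)
open import Data.Vec.Relation.Binary.Equality.Setoid using (≋-setoid)
open import Data.Vec.Relation.Binary.Pointwise.Inductive using ([]; _∷_)
open import Data.Vec.Relation.Unary.Any as VecAny using (Any)
open import Function.Base using (_∘_)
open import Relation.Binary.Bundles using (Setoid)
open import Relation.Binary.PropositionalEquality
open import Relation.Nullary.Decidable using (Dec; _×-dec_; _→-dec_)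
open import Relation.Unary using (Pred; Decidable)

open import Algebra.Properties.CommutativeMonoid.Sum ℚ.+-0-commutativeMonoid using (sum-syntax)

-- Rows and columns are indexed by Fin n, so that i : Fin n stands for
-- the row (or column) number suc (toℕ i).

NonTrivialEntry : ∀ {n k} → Vec (Permutation′ n) k → Fin n → Fin n → Set
NonTrivialEntry G i j =
  i < j × Any (λ π → (∀ t → t < i → π ⟨$⟩ʳ t ≡ t) × π ⟨$⟩ʳ j ≡ i) G

nonTrivialEntry? : ∀ {n k} (G : Vec (Permutation′ n) k) i j → Dec (NonTrivialEntry G i j)
nonTrivialEntry? G i j =
  (i <? j) ×-dec
  VecAny.any? (λ π → all? (λ t → (t <? i) →-dec (π ⟨$⟩ʳ t ≟ t)) ×-dec (π ⟨$⟩ʳ j ≟ i)) G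

Effective : ∀ {n k} → Vec (Permutation′ n) k → Fin n → Set
Effective G i = ∃ λ j → NonTrivialEntry G i j

effective? : ∀ {n k} (G : Vec (Permutation′ n) k) → Decidable (Effective G)
effective? G i = any? (nonTrivialEntry? G i)

-- The number r (counting rows from 1), or 0 if no row is effective.
maxEffectiveRow : ∀ {n k} → Vec (Permutation′ n) k → ℕ
maxEffectiveRow {n} G = max 0 (map (suc ∘ toℕ) (filter (effective? G) (allFin n)))

-- A permutation of Fin (suc n) amounts to the image of zero together
-- with a permutation of Fin n.
allPermutations : ∀ n → List (Permutation′ n)
allPermutations zero    = id ∷ []
allPermutations (suc n) = cartesianProductWith (insert zero) (allFin (suc n)) (allPermutations n)

allSequences : ∀ {a} {A : Set a} (k : ℕ) → List A → List (Vec A k)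
allSequences zero    xs = [] ∷ []
allSequences (suc k) xs = cartesianProductWith _∷_ xs (allSequences k xs)

-- Each permutation, respectively each sequence, is listed exactly once
-- up to pointwise equality.

Sym : ℕ → Setoid _ _
Sym n = record
  { Carrier       = Permutation′ n
  ; _≈_           = _≈_
  ; isEquivalence = record
    { refl  = λ _ → refl
    ; sym   = λ p i → sym (p i)
    ; trans = λ p q i → trans (p i) (q i)
    }
  }

private
  insert-cong : ∀ {n} {i j : Fin (suc n)} {π ρ : Permutation′ n} →
                i ≡ j → π ≈ ρ → insert zero i π ≈ insert zero j ρ
  insert-cong refl π≈ρ zero = refl
  insert-cong {i = i} {π = π} {ρ} refl π≈ρ (suc t) = begin
    insert zero i π ⟨$⟩ʳ suc t  ≡⟨ insert-punchIn zero i π t ⟩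
    _                           ≡⟨ cong (punchIn i) (π≈ρ t) ⟩
    _                           ≡⟨ insert-punchIn zero i ρ t ⟨
    insert zero i ρ ⟨$⟩ʳ suc t  ∎
    where open ≡-Reasoning

  insert-injective : ∀ {n} {i j : Fin (suc n)} {π ρ : Permutation′ n} →
                     insert zero i π ≈ insert zero j ρ → i ≡ j × π ≈ ρ
  insert-injective {i = i} {j} {π} {ρ} eq with eq zero
  ... | refl = refl , λ t → punchIn-injective i _ _
    (trans (sym (insert-punchIn zero i π t)) (trans (eq (suc t)) (insert-punchIn zero i ρ t)))

  length-cartesianProductWith : ∀ {a b c} {A : Set a} {B : Set b} {C : Set c} (f : A → B → C) xs ys →
                                length (cartesianProductWith f xs ys) ≡ length xs * length ys
  length-cartesianProductWith f []       ys = refl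
  length-cartesianProductWith f (x ∷ xs) ys =
    trans (length-++ (map (f x) ys)) (cong₂ _+_ (length-map (f x) ys) (length-cartesianProductWith f xs ys))

allPermutations-complete : ∀ n → Enumerates.IsEnumeration (Sym n) (allPermutations n)
allPermutations-complete zero    π = here λ ()
allPermutations-complete (suc n) π = Any.cartesianProductWith⁺ (insert zero)
  (λ {_} {ρ} p q t → trans (sym (insert-remove zero π t)) (insert-cong {π = remove zero π} {ρ} p q t))
  (∈-allFin (π ⟨$⟩ʳ zero))
  (allPermutations-complete n (remove zero π))

allPermutations-unique : ∀ n → UniqueSetoid.Unique (Sym n) (allPermutations n)
allPermutations-unique zero    = [] ∷ []
allPermutations-unique (suc n) = UniqueProperties.cartesianProductWith⁺
  (setoid (Fin (suc n))) (Sym n) (Sym (suc n)) (insert zero)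
  (λ {_} {_} {π} {ρ} → insert-injective {π = π} {ρ})
  (Unique≡.allFin⁺ (suc n)) (allPermutations-unique n)

length-allPermutations : ∀ n → length (allPermutations n) ≡ n !
length-allPermutations zero    = refl
length-allPermutations (suc n) = trans
  (length-cartesianProductWith (insert zero) (allFin (suc n)) (allPermutations n))
  (cong₂ _*_ (length-tabulate {n = suc n} (λ i → i)) (length-allPermutations n))

module _ {a ℓ} (S : Setoid a ℓ) {xs : List (Setoid.Carrier S)} where

  allSequences-complete : Enumerates.IsEnumeration S xs →
                          ∀ k → Enumerates.IsEnumeration (≋-setoid S k) (allSequences k xs)
  allSequences-complete enum zero    []      = here []
  allSequences-complete enum (suc k) (x ∷ v) =
    Any.cartesianProductWith⁺ _∷_ _∷_ (enum x) (allSequences-complete enum k v)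

  allSequences-unique : UniqueSetoid.Unique S xs →
                        ∀ k → UniqueSetoid.Unique (≋-setoid S k) (allSequences k xs)
  allSequences-unique xs! zero    = [] ∷ []
  allSequences-unique xs! (suc k) = UniqueProperties.cartesianProductWith⁺
    S (≋-setoid S k) (≋-setoid S (suc k)) _∷_ (λ { (p ∷ q) → p , q })
    xs! (allSequences-unique xs! k)

length-allSequences : ∀ {a} {A : Set a} k (xs : List A) → length (allSequences k xs) ≡ length xs ^ k
length-allSequences zero    xs = refl
length-allSequences (suc k) xs = trans
  (length-cartesianProductWith _∷_ xs (allSequences k xs))
  (cong (length xs *_) (length-allSequences k xs))

sampleSpace : ∀ n k → List (Vec (Permutation′ n) k)
sampleSpace n k = allSequences k (allPermutations n)

length-sampleSpace : ∀ n k → length (sampleSpace n k) ≡ (n !) ^ k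
length-sampleSpace n k =
  trans (length-allSequences k (allPermutations n)) (cong (_^ k) (length-allPermutations n))

sampleSpace-nonZero : ∀ n k → NonZero (length (sampleSpace n k))
sampleSpace-nonZero n k =
  subst NonZero (sym (length-sampleSpace n k)) (ℕ.m^n≢0 (n !) k {{n ℕ.!≢0}})

uniformProbability : ∀ {a p} {A : Set a} (Ω : List A) .{{_ : NonZero (length Ω)}} →
                     {P : Pred A p} → Decidable P → ℚ
uniformProbability Ω P? = + length (filter P? Ω) / length Ω

-- ℙ(r = i) for k independent uniform permutations of degree n.
probMaxEffectiveRow : (n k i : ℕ) → ℚ
probMaxEffectiveRow n k i =
  uniformProbability (sampleSpace n k) {{sampleSpace-nonZero n k}} (λ G → maxEffectiveRow G ℕ.≟ i)

expectedMaxEffectiveRow : (n k : ℕ) → ℚ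
expectedMaxEffectiveRow n k =
  ∑[ i < n ] ((+ suc (toℕ i) / 1) ℚ.* probMaxEffectiveRow n k (suc (toℕ i)))

{-# OPTIONS --safe #-}

-- If row i of the table of G is effective, then some π in G fixes the first
-- i − 1 points, so i − 1 is at most the total number of leading fixed points of
-- the members of G; hence so is r − 1.  Summed over Sym(n), the number of leading
-- fixed points is (n−1)! + (n−2)! + … + 0! ≤ 2 (n−1)!, i.e. at most 2/n on average.

module Submission where

open import Defs
import Algebra.Properties.CommutativeMonoid.Sum as Sum
open import Data.Bool.Base using (true; false; if_then_else_)
open import Data.Fin.Base as Fin using (Fin; zero; suc; toℕ)
open import Data.Fin.Permutation using (Permutation′; _⟨$⟩ʳ_; insert; insert-punchIn)
import Data.Fin.Properties as Fin
open import Data.Integer.Base as ℤ using (+_)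
import Data.Integer.Properties as ℤ
open import Data.List.Base using (List; []; _∷_; _++_; length; map; filter; allFin; tabulate; cartesianProductWith)
open import Data.List.Extrema.Nat using (max≤v⁺)
open import Data.List.Properties using (map-++; map-∘; map-cong)
import Data.List.Relation.Unary.All as All
import Data.List.Relation.Unary.All.Properties as All
open import Data.Nat.Base as ℕ using (ℕ; zero; suc; NonZero; _*_; _^_; _!; z≤n; s≤s)
open import Data.Nat.ListAction using (sum)
open import Data.Nat.ListAction.Properties using (sum-++)
import Data.Nat.Properties as ℕ
open import Data.Nat.Tactic.RingSolver using (solve-∀)
open import Data.Product.Base using (_×_; _,_)
open import Data.Rational.Base as ℚ using (1ℚ; _/_; _+_; _≤_; toℚᵘ)
import Data.Rational.Properties as ℚ
import Data.Rational.Unnormalised.Base as ℚᵘ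
import Data.Rational.Unnormalised.Properties as ℚᵘ
open import Data.Vec.Base as Vec using (Vec; _∷_)
open import Data.Vec.Relation.Unary.Any using (Any; here; there)
open import Function.Base using (_∘_; id)
open import Function.Definitions using (Injective)
open import Relation.Binary.PropositionalEquality
open import Relation.Nullary.Decidable using (Dec; does; yes; no)
open import Relation.Nullary.Negation using (¬_; contradiction)
open import Relation.Unary using (Pred; Decidable)

module ℕΣ = Sum ℕ.+-0-commutativeMonoid
module ℚΣ = Sum ℚ.+-0-commutativeMonoid

-- Indicators and their weighted sums

indicator : ∀ {p} {P : Set p} → Dec P → ℕ
indicator P? = if does P? then 1 else 0

*-indicator≤ : ∀ {p} {P : Set p} (P? : Dec P) m → m * indicator P? ℕ.≤ m
*-indicator≤ (yes _) m = ℕ.≤-reflexive (ℕ.*-identityʳ m)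
*-indicator≤ (no  _) m = ℕ.≤-trans (ℕ.≤-reflexive (ℕ.*-zeroʳ m)) z≤n

*-indicator-no : ∀ {p} {P : Set p} (P? : Dec P) m → ¬ P → m * indicator P? ≡ 0
*-indicator-no (yes p) m ¬p = contradiction p ¬p
*-indicator-no (no  _) m ¬p = ℕ.*-zeroʳ m

-- By injectivity `m` equals `f i` for at most one `i`, and that term is worth `m`. Only an
-- inequality holds, since `f` may miss `m`.
∑-indicator≤ : ∀ {n} (f : Fin n → ℕ) → Injective _≡_ _≡_ f →
               ∀ m → ℕΣ.sum (λ i → f i * indicator (m ℕ.≟ f i)) ℕ.≤ m
∑-indicator≤ {zero}  f f-inj m = z≤n
∑-indicator≤ {suc n} f f-inj m with m ℕ.≟ f zero
... | no  m≢f0 = ℕ.+-mono-≤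
  (ℕ.≤-reflexive (*-indicator-no (m ℕ.≟ f zero) (f zero) m≢f0))
  (∑-indicator≤ (f ∘ suc) (Fin.suc-injective ∘ f-inj) m)
-- The head already accounts for all of `m`, which is now `f zero`; injectivity makes every later
-- term vanish.
... | yes refl = begin
  f zero * indicator (f zero ℕ.≟ f zero) ℕ.+ ℕΣ.sum (λ i → f (suc i) * indicator (f zero ℕ.≟ f (suc i)))
    ≤⟨ ℕ.+-mono-≤ (*-indicator≤ (f zero ℕ.≟ f zero) (f zero)) (ℕ.≤-reflexive (ℕΣ.sum-cong-≗ vanish)) ⟩
  f zero ℕ.+ ℕΣ.sum {n} (λ _ → 0)
    ≡⟨ cong (f zero ℕ.+_) (ℕΣ.sum-replicate-zero n) ⟩
  f zero ℕ.+ 0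
    ≡⟨ ℕ.+-identityʳ (f zero) ⟩
  f zero ∎
  where
  open ℕ.≤-Reasoning
  vanish : ∀ i → f (suc i) * indicator (f zero ℕ.≟ f (suc i)) ≡ 0
  vanish i = *-indicator-no (f zero ℕ.≟ f (suc i)) (f (suc i)) λ eq → contradiction (f-inj eq) λ ()

-- Sums over lists, products of lists and fibres

module _ {a} {A : Set a} where

  sum-map-mono : {f g : A → ℕ} → (∀ x → f x ℕ.≤ g x) →
                 ∀ xs → sum (map f xs) ℕ.≤ sum (map g xs)
  sum-map-mono f≤g []       = z≤n
  sum-map-mono f≤g (x ∷ xs) = ℕ.+-mono-≤ (f≤g x) (sum-map-mono f≤g xs)

  sum-map-const : ∀ c (xs : List A) → sum (map (λ _ → c) xs) ≡ length xs * c
  sum-map-const c []       = refl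
  sum-map-const c (x ∷ xs) = cong (c ℕ.+_) (sum-map-const c xs)

  sum-map-+ : ∀ (f g : A → ℕ) xs →
              sum (map (λ x → f x ℕ.+ g x) xs) ≡ sum (map f xs) ℕ.+ sum (map g xs)
  sum-map-+ f g []       = refl
  sum-map-+ f g (x ∷ xs) = trans (cong (f x ℕ.+ g x ℕ.+_) (sum-map-+ f g xs))
    (interchange (f x) (g x) (sum (map f xs)) (sum (map g xs)))
    where
    interchange : ∀ a b c d → a ℕ.+ b ℕ.+ (c ℕ.+ d) ≡ a ℕ.+ c ℕ.+ (b ℕ.+ d)
    interchange = solve-∀

  sum-map-*ʳ : ∀ (f : A → ℕ) c xs → sum (map (λ x → f x * c) xs) ≡ sum (map f xs) * c
  sum-map-*ʳ f c []       = refl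
  sum-map-*ʳ f c (x ∷ xs) = trans (cong (f x * c ℕ.+_) (sum-map-*ʳ f c xs))
    (sym (ℕ.*-distribʳ-+ c (f x) (sum (map f xs))))

  sum-cartesianProductWith : ∀ {b c} {B : Set b} {C : Set c} (h : C → ℕ) (f : A → B → C) xs ys →
    sum (map h (cartesianProductWith f xs ys)) ≡ sum (map (λ x → sum (map (h ∘ f x) ys)) xs)
  sum-cartesianProductWith h f []       ys = refl
  sum-cartesianProductWith h f (x ∷ xs) ys = begin
    sum (map h (map (f x) ys ++ rest))                 ≡⟨ cong sum (map-++ h (map (f x) ys) rest) ⟩
    sum (map h (map (f x) ys) ++ map h rest)           ≡⟨ sum-++ (map h (map (f x) ys)) (map h rest) ⟩
    sum (map h (map (f x) ys)) ℕ.+ sum (map h rest)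
      ≡⟨ cong₂ ℕ._+_ (cong sum (sym (map-∘ ys))) (sum-cartesianProductWith h f xs ys) ⟩
    sum (map (h ∘ f x) ys) ℕ.+ sum (map (λ x → sum (map (h ∘ f x) ys)) xs) ∎
    where
    open ≡-Reasoning
    rest = cartesianProductWith f xs ys

  length-filter-∷ : ∀ {p} {P : Pred A p} (P? : Decidable P) x xs →
                    length (filter P? (x ∷ xs)) ≡ indicator (P? x) ℕ.+ length (filter P? xs)
  length-filter-∷ P? x xs with does (P? x)
  ... | true  = refl
  ... | false = refl

  -- Double counting: each `x` contributes `f i` for those `i` with `h x ≡ f i`, hence at most `h x`
  -- altogether. This passes from the counts of outcomes with r = i to the sum of r over all
  -- outcomes.
  ∑-fibres≤ : ∀ {n} (f : Fin n → ℕ) → Injective _≡_ _≡_ f → ∀ (h : A → ℕ) xs →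
              ℕΣ.sum (λ i → f i * length (filter (λ x → h x ℕ.≟ f i) xs)) ℕ.≤ sum (map h xs)
  ∑-fibres≤ {n} f f-inj h [] = ℕ.≤-reflexive
    (trans (ℕΣ.sum-cong-≗ (λ i → ℕ.*-zeroʳ (f i))) (ℕΣ.sum-replicate-zero n))
  ∑-fibres≤ f f-inj h (x ∷ xs) = begin
    ℕΣ.sum (λ i → f i * length (filter (λ x → h x ℕ.≟ f i) (x ∷ xs)))
      ≡⟨ ℕΣ.sum-cong-≗ (λ i → trans
           (cong (f i *_) (length-filter-∷ (λ x → h x ℕ.≟ f i) x xs))
           (ℕ.*-distribˡ-+ (f i) (indicator (h x ℕ.≟ f i)) _)) ⟩
    ℕΣ.sum (λ i → f i * indicator (h x ℕ.≟ f i) ℕ.+ f i * length (filter (λ x → h x ℕ.≟ f i) xs))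
      ≡⟨ ℕΣ.∑-distrib-+ (λ i → f i * indicator (h x ℕ.≟ f i)) _ ⟩
    ℕΣ.sum (λ i → f i * indicator (h x ℕ.≟ f i)) ℕ.+
    ℕΣ.sum (λ i → f i * length (filter (λ x → h x ℕ.≟ f i) xs))
      ≤⟨ ℕ.+-mono-≤ (∑-indicator≤ f f-inj (h x)) (∑-fibres≤ f f-inj h xs) ⟩
    h x ℕ.+ sum (map h xs) ∎
    where open ℕ.≤-Reasoning

-- Leading fixed points as common prefixes

-- The domain and codomain sizes are independent because the recursion shrinks only the domain: one
-- step turns the identity into `suc`.
commonPrefix : ∀ {m n} → (Fin n → Fin m) → (Fin n → Fin m) → ℕ
commonPrefix {n = zero}  f g = 0
commonPrefix {n = suc n} f g =
  if does (f zero Fin.≟ g zero) then suc (commonPrefix (f ∘ suc) (g ∘ suc)) else 0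

commonPrefix-congˡ : ∀ {m n} {f f′ : Fin n → Fin m} → f ≗ f′ → ∀ g →
                     commonPrefix f g ≡ commonPrefix f′ g
commonPrefix-congˡ {n = zero}  f≗f′ g = refl
commonPrefix-congˡ {n = suc n} f≗f′ g = cong₂ (λ i c → if does (i Fin.≟ g zero) then suc c else 0)
  (f≗f′ zero) (commonPrefix-congˡ (f≗f′ ∘ suc) (g ∘ suc))

-- Once a fixed zero is split off, both functions take successor values; deciding equality of
-- successors computes to deciding equality of their predecessors.
commonPrefix-suc : ∀ {m n} (f g : Fin n → Fin m) →
                   commonPrefix (Fin.suc ∘ f) (Fin.suc ∘ g) ≡ commonPrefix f g
commonPrefix-suc {n = zero}  f g = refl
commonPrefix-suc {n = suc n} f g =
  cong (λ c → if does (f zero Fin.≟ g zero) then suc c else 0) (commonPrefix-suc (f ∘ suc) (g ∘ suc))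

toℕ≤commonPrefix : ∀ {m n} (f g : Fin n → Fin m) (i : Fin n) →
                   (∀ t → t Fin.< i → f t ≡ g t) → toℕ i ℕ.≤ commonPrefix f g
toℕ≤commonPrefix f g zero    agree = z≤n
toℕ≤commonPrefix f g (suc i) agree with f zero Fin.≟ g zero
... | yes _  = s≤s (toℕ≤commonPrefix (f ∘ suc) (g ∘ suc) i (λ t t<i → agree (suc t) (s≤s t<i)))
... | no  f≢g = contradiction (agree zero (s≤s z≤n)) f≢g

leadingFixedPoints : ∀ {n} → Permutation′ n → ℕ
leadingFixedPoints π = commonPrefix (π ⟨$⟩ʳ_) id

leadingFixedPoints-insert-zero : ∀ {n} (π : Permutation′ n) →
  leadingFixedPoints (insert zero zero π) ≡ suc (leadingFixedPoints π)
leadingFixedPoints-insert-zero π = cong suc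
  (trans (commonPrefix-congˡ (insert-punchIn zero zero π) suc) (commonPrefix-suc (π ⟨$⟩ʳ_) id))

-- Total number of leading fixed points over Sym(n)

totalLeadingFixedPoints : ℕ → ℕ
totalLeadingFixedPoints n = sum (map leadingFixedPoints (allPermutations n))

-- Split by the image of zero. Each of the `n !` permutations fixing it has one leading fixed point
-- more than the permutation it induces on the rest; those moving it have none.
totalLeadingFixedPoints-suc : ∀ n →
  totalLeadingFixedPoints (suc n) ≡ n ! ℕ.+ totalLeadingFixedPoints n
totalLeadingFixedPoints-suc n = begin
  totalLeadingFixedPoints (suc n)
    ≡⟨ sum-cartesianProductWith leadingFixedPoints (insert zero) (allFin (suc n)) πs ⟩
  sum (map (leadingFixedPoints ∘ insert zero zero) πs) ℕ.+
  sum (map (λ j → sum (map (leadingFixedPoints ∘ insert zero j) πs)) (tabulate suc))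
    ≡⟨ cong₂ ℕ._+_ (cong sum (map-cong leadingFixedPoints-insert-zero πs)) (moved n id) ⟩
  sum (map (λ π → 1 ℕ.+ leadingFixedPoints π) πs) ℕ.+ 0
    ≡⟨ ℕ.+-identityʳ _ ⟩
  sum (map (λ π → 1 ℕ.+ leadingFixedPoints π) πs)
    ≡⟨ sum-map-+ (λ _ → 1) leadingFixedPoints πs ⟩
  sum (map (λ _ → 1) πs) ℕ.+ totalLeadingFixedPoints n
    ≡⟨ cong (ℕ._+ totalLeadingFixedPoints n) (trans (sum-map-const 1 πs) (ℕ.*-identityʳ _)) ⟩
  length πs ℕ.+ totalLeadingFixedPoints n
    ≡⟨ cong (ℕ._+ totalLeadingFixedPoints n) (length-allPermutations n) ⟩
  n ! ℕ.+ totalLeadingFixedPoints n ∎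
  where
  open ≡-Reasoning
  πs = allPermutations n

  -- The image of zero is a successor here, so every summand computes to 0. Generalising over `f`
  -- lets the induction follow `tabulate`.
  moved : ∀ m (f : Fin m → Fin n) →
    sum (map (λ j → sum (map (leadingFixedPoints ∘ insert zero j) πs)) (tabulate (suc ∘ f))) ≡ 0
  moved zero    f = refl
  moved (suc m) f = cong₂ ℕ._+_ (trans (sum-map-const 0 πs) (ℕ.*-zeroʳ (length πs))) (moved m (f ∘ suc))

-- Mutual induction with the bound by a single factorial: the leading term of the recursion is one
-- copy of `(suc n) !`, and `bound` supplies the other.
totalLeadingFixedPoints≤ : ∀ n → totalLeadingFixedPoints (suc n) ℕ.≤ 2 * n !
totalLeadingFixedPoints≤ zero    = ℕ.≤-trans (ℕ.≤-reflexive (totalLeadingFixedPoints-suc 0)) (s≤s z≤n)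
totalLeadingFixedPoints≤ (suc n) = begin
  totalLeadingFixedPoints (2 ℕ.+ n)            ≡⟨ totalLeadingFixedPoints-suc (suc n) ⟩
  (suc n) ! ℕ.+ totalLeadingFixedPoints (suc n) ≤⟨ ℕ.+-monoʳ-≤ ((suc n) !) (bound n) ⟩
  (suc n) ! ℕ.+ (suc n) !                      ≡⟨ cong ((suc n) ! ℕ.+_) (ℕ.+-identityʳ _) ⟨
  2 * (suc n) !                                ∎
  where
  open ℕ.≤-Reasoning
  bound : ∀ n → totalLeadingFixedPoints (suc n) ℕ.≤ (suc n) !
  bound zero    = ℕ.≤-reflexive (totalLeadingFixedPoints-suc 0)
  -- The factor 2 is absorbed by the first factor of the next factorial, which is at least 2.
  bound (suc n) = ℕ.≤-trans (totalLeadingFixedPoints≤ (suc n))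
    (ℕ.*-monoˡ-≤ ((suc n) !) (s≤s (s≤s (z≤n {n}))))

-- The average bound 2/n with denominators cleared, which keeps the argument in the naturals.
*-totalLeadingFixedPoints≤ : ∀ n → n * totalLeadingFixedPoints n ℕ.≤ 2 * n !
*-totalLeadingFixedPoints≤ zero    = z≤n
*-totalLeadingFixedPoints≤ (suc n) = ℕ.≤-trans
  (ℕ.*-monoʳ-≤ (suc n) (totalLeadingFixedPoints≤ n))
  (ℕ.≤-reflexive (swap (suc n) (n !)))
  where
  swap : ∀ a b → a * (2 * b) ≡ 2 * (a * b)
  swap = solve-∀

-- Averaging over sequences

seqLeadingFixedPoints : ∀ {n k} → Vec (Permutation′ n) k → ℕ
seqLeadingFixedPoints G = Vec.sum (Vec.map leadingFixedPoints G)

-- Split off the first entry: every `x` heads `length xs ^ k` sequences, and every tail occurs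
-- behind `length xs` heads.
sum-allSequences : ∀ {a} {A : Set a} (f : A → ℕ) k xs →
  sum (map (Vec.sum ∘ Vec.map f) (allSequences (suc k) xs)) ≡
  length xs ^ k * sum (map f xs) ℕ.+ length xs * sum (map (Vec.sum ∘ Vec.map f) (allSequences k xs))
sum-allSequences f k xs = begin
  sum (map F (allSequences (suc k) xs))
    ≡⟨ sum-cartesianProductWith F _∷_ xs vs ⟩
  sum (map (λ x → sum (map (λ v → f x ℕ.+ F v) vs)) xs)
    ≡⟨ cong sum (map-cong (λ x → trans (sum-map-+ (λ _ → f x) F vs)
         (cong (ℕ._+ sum (map F vs)) (trans (sum-map-const (f x) vs) (ℕ.*-comm (length vs) (f x))))) xs) ⟩
  sum (map (λ x → f x * length vs ℕ.+ sum (map F vs)) xs)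
    ≡⟨ sum-map-+ (λ x → f x * length vs) (λ _ → sum (map F vs)) xs ⟩
  sum (map (λ x → f x * length vs) xs) ℕ.+ sum (map (λ _ → sum (map F vs)) xs)
    ≡⟨ cong₂ ℕ._+_ (trans (sum-map-*ʳ f (length vs) xs) (ℕ.*-comm (sum (map f xs)) (length vs)))
                   (sum-map-const (sum (map F vs)) xs) ⟩
  length vs * sum (map f xs) ℕ.+ length xs * sum (map F vs)
    ≡⟨ cong (λ l → l * sum (map f xs) ℕ.+ length xs * sum (map F vs)) (length-allSequences k xs) ⟩
  length xs ^ k * sum (map f xs) ℕ.+ length xs * sum (map F vs) ∎
  where
  open ≡-Reasoning
  F : ∀ {k} → Vec _ k → ℕ
  F = Vec.sum ∘ Vec.map f
  vs = allSequences k xs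

-- Linearity of expectation with denominators cleared: if `f` averages at most c/n, the sum of `f`
-- over k independent entries averages at most ck/n.
*-sum-allSequences≤ : ∀ {a} {A : Set a} (f : A → ℕ) n c xs → n * sum (map f xs) ℕ.≤ c * length xs →
  ∀ k → n * sum (map (Vec.sum ∘ Vec.map f) (allSequences k xs)) ℕ.≤ c * k * length (allSequences k xs)
*-sum-allSequences≤ f n c xs bound zero    = ℕ.≤-trans (ℕ.≤-reflexive (ℕ.*-zeroʳ n)) z≤n
*-sum-allSequences≤ f n c xs bound (suc k) = begin
  n * sum (map F (allSequences (suc k) xs))    ≡⟨ cong (n *_) (sum-allSequences f k xs) ⟩
  n * (N ^ k * W ℕ.+ N * S)                    ≡⟨ distrib n (N ^ k) W N S ⟩
  N ^ k * (n * W) ℕ.+ N * (n * S)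
    ≤⟨ ℕ.+-mono-≤ (ℕ.*-monoʳ-≤ (N ^ k) bound) (ℕ.*-monoʳ-≤ N (*-sum-allSequences≤ f n c xs bound k)) ⟩
  N ^ k * (c * N) ℕ.+ N * (c * k * length (allSequences k xs))
    ≡⟨ cong (λ l → N ^ k * (c * N) ℕ.+ N * (c * k * l)) (length-allSequences k xs) ⟩
  N ^ k * (c * N) ℕ.+ N * (c * k * N ^ k)      ≡⟨ collect N (N ^ k) c k ⟩
  c * suc k * (N * N ^ k)                      ≡⟨ cong (c * suc k *_) (length-allSequences (suc k) xs) ⟨
  c * suc k * length (allSequences (suc k) xs) ∎
  where
  open ℕ.≤-Reasoning
  F : ∀ {k} → Vec _ k → ℕ
  F = Vec.sum ∘ Vec.map f
  N = length xs
  W = sum (map f xs)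
  S = sum (map F (allSequences k xs))

  distrib : ∀ n P W N S → n * (P * W ℕ.+ N * S) ≡ P * (n * W) ℕ.+ N * (n * S)
  distrib = solve-∀

  collect : ∀ N P c k → P * (c * N) ℕ.+ N * (c * k * P) ≡ c * suc k * (N * P)
  collect = solve-∀

-- Bounding the maximal effective row

-- The zero-based `toℕ i` counts the points before row `i`, all fixed by the member found; the
-- remaining members can only enlarge the sum.
fixing-member≤ : ∀ {n k} {G : Vec (Permutation′ n) k} {i j} →
  Any (λ π → (∀ t → t Fin.< i → π ⟨$⟩ʳ t ≡ t) × π ⟨$⟩ʳ j ≡ i) G →
  toℕ i ℕ.≤ seqLeadingFixedPoints G
fixing-member≤ {G = π ∷ G} {i} (here (fixes , _)) =
  ℕ.≤-trans (toℕ≤commonPrefix (π ⟨$⟩ʳ_) id i fixes) (ℕ.m≤m+n (leadingFixedPoints π) _)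
fixing-member≤ {G = π ∷ G} (there G∋π) =
  ℕ.≤-trans (fixing-member≤ G∋π) (ℕ.m≤n+m _ (leadingFixedPoints π))

maxEffectiveRow≤ : ∀ {n k} (G : Vec (Permutation′ n) k) →
                   maxEffectiveRow G ℕ.≤ 1 ℕ.+ seqLeadingFixedPoints G
-- `z≤n` handles the default 0 of `max`, hence sequences without an effective row; `s≤s` shifts
-- zero-based indices to row numbers.
maxEffectiveRow≤ {n} G = max≤v⁺ z≤n
  (All.map⁺ (All.map (λ { (_ , _ , G∋π) → s≤s (fixing-member≤ G∋π) })
                     (All.all-filter (effective? G) (allFin n))))

-- This is the bound 1 + 2k/n on the mean of r, multiplied by n and by the size of the sample space.
sum-maxEffectiveRow≤ : ∀ n k →
  n * sum (map maxEffectiveRow (sampleSpace n k)) ℕ.≤ (n ℕ.+ 2 * k) * length (sampleSpace n k)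
sum-maxEffectiveRow≤ n k = begin
  n * sum (map maxEffectiveRow Ω)
    ≤⟨ ℕ.*-monoʳ-≤ n (sum-map-mono maxEffectiveRow≤ Ω) ⟩
  n * sum (map (λ G → 1 ℕ.+ seqLeadingFixedPoints G) Ω)
    ≡⟨ cong (n *_) (trans (sum-map-+ (λ _ → 1) seqLeadingFixedPoints Ω)
         (cong (ℕ._+ S) (trans (sum-map-const 1 Ω) (ℕ.*-identityʳ (length Ω))))) ⟩
  n * (length Ω ℕ.+ S)
    ≡⟨ ℕ.*-distribˡ-+ n (length Ω) S ⟩
  n * length Ω ℕ.+ n * S
    ≤⟨ ℕ.+-monoʳ-≤ (n * length Ω) (*-sum-allSequences≤ leadingFixedPoints n 2 (allPermutations n) average k) ⟩
  n * length Ω ℕ.+ 2 * k * length Ω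
    ≡⟨ ℕ.*-distribʳ-+ (length Ω) n (2 * k) ⟨
  (n ℕ.+ 2 * k) * length Ω ∎
  where
  open ℕ.≤-Reasoning
  Ω = sampleSpace n k
  S = sum (map seqLeadingFixedPoints Ω)

  average : n * totalLeadingFixedPoints n ℕ.≤ 2 * length (allPermutations n)
  average = subst (λ l → n * totalLeadingFixedPoints n ℕ.≤ 2 * l)
    (sym (length-allPermutations n)) (*-totalLeadingFixedPoints≤ n)

-- Arithmetic of rational fractions

-- Fractions in ℚ are reduced to lowest terms; the unnormalised form exposes the given numerator and
-- denominator for cross-multiplication.
toℚᵘ-/ : ∀ i d .{{_ : NonZero d}} → toℚᵘ (i / d) ℚᵘ.≃ (i ℚᵘ./ d)
toℚᵘ-/ i (suc d) = ℚ.toℚᵘ-fromℚᵘ (ℚᵘ.mkℚᵘ i d)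

/-mono-≤-× : ∀ a b c d .{{_ : NonZero b}} .{{_ : NonZero d}} →
             a * d ℕ.≤ c * b → + a / b ≤ + c / d
/-mono-≤-× a b@(suc _) c d@(suc _) ad≤cb = ℚ.toℚᵘ-cancel-≤
  (ℚᵘ.≤-respˡ-≃ (ℚᵘ.≃-sym (toℚᵘ-/ (+ a) b)) (ℚᵘ.≤-respʳ-≃ (ℚᵘ.≃-sym (toℚᵘ-/ (+ c) d))
    (ℚᵘ.*≤* (subst₂ ℤ._≤_ (ℤ.pos-* a d) (ℤ.pos-* c b) (ℤ.+≤+ ad≤cb)))))

/-distribʳ-+ : ∀ a b d .{{_ : NonZero d}} → + a / d + + b / d ≡ + (a ℕ.+ b) / d
/-distribʳ-+ a b d@(suc _) = ℚ.toℚᵘ-injective (begin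
  toℚᵘ (+ a / d + + b / d)             ≈⟨ ℚ.toℚᵘ-homo-+ (+ a / d) (+ b / d) ⟩
  toℚᵘ (+ a / d) ℚᵘ.+ toℚᵘ (+ b / d)   ≈⟨ ℚᵘ.+-cong (toℚᵘ-/ (+ a) d) (toℚᵘ-/ (+ b) d) ⟩
  (+ a ℚᵘ./ d) ℚᵘ.+ (+ b ℚᵘ./ d)       ≈⟨ ℚᵘ.*≡* cross ⟩
  + (a ℕ.+ b) ℚᵘ./ d                   ≈⟨ toℚᵘ-/ (+ (a ℕ.+ b)) d ⟨
  toℚᵘ (+ (a ℕ.+ b) / d)               ∎)
  where
  open ℚᵘ.≃-Reasoning
  cross : (+ a ℤ.* + d ℤ.+ + b ℤ.* + d) ℤ.* + d ≡ + (a ℕ.+ b) ℤ.* (+ d ℤ.* + d)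
  cross = trans (cong (ℤ._* + d) (sym (ℤ.*-distribʳ-+ (+ d) (+ a) (+ b))))
                (ℤ.*-assoc (+ (a ℕ.+ b)) (+ d) (+ d))

/1-*-/ : ∀ a b d .{{_ : NonZero d}} → (+ a / 1) ℚ.* (+ b / d) ≡ + (a * b) / d
/1-*-/ a b d@(suc d-1) = ℚ.toℚᵘ-injective (begin
  toℚᵘ ((+ a / 1) ℚ.* (+ b / d))        ≈⟨ ℚ.toℚᵘ-homo-* (+ a / 1) (+ b / d) ⟩
  toℚᵘ (+ a / 1) ℚᵘ.* toℚᵘ (+ b / d)    ≈⟨ ℚᵘ.*-cong (toℚᵘ-/ (+ a) 1) (toℚᵘ-/ (+ b) d) ⟩
  (+ a ℚᵘ./ 1) ℚᵘ.* (+ b ℚᵘ./ d)        ≈⟨ ℚᵘ.*≡* (cong₂ ℤ._*_ (sym (ℤ.pos-* a b))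
                                            (cong (λ m → + suc m) (sym (ℕ.+-identityʳ d-1)))) ⟩
  + (a * b) ℚᵘ./ d                      ≈⟨ toℚᵘ-/ (+ (a * b)) d ⟨
  toℚᵘ (+ (a * b) / d)                  ∎)
  where open ℚᵘ.≃-Reasoning

n/n≡1 : ∀ n .{{_ : NonZero n}} → + n / n ≡ 1ℚ
n/n≡1 n@(suc _) = ℚ.toℚᵘ-injective (ℚᵘ.≃-trans (toℚᵘ-/ (+ n) n)
  (ℚᵘ.*≡* (ℤ.*-comm (+ n) (+ 1))))

∑-/ : ∀ {n} (f g : Fin n → ℕ) d .{{_ : NonZero d}} →
      ℚΣ.sum (λ i → (+ f i / 1) ℚ.* (+ g i / d)) ≡ + ℕΣ.sum (λ i → f i * g i) / d
-- The empty sum is 0/1, which is identified with 0/d by comparing the two in both directions.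
∑-/ {zero}  f g d@(suc _) = sym (ℚ.≤-antisym (/-mono-≤-× 0 d 0 1 z≤n) (/-mono-≤-× 0 1 0 d z≤n))
∑-/ {suc n} f g d = trans
  (cong₂ _+_ (/1-*-/ (f zero) (g zero) d) (∑-/ (f ∘ suc) (g ∘ suc) d))
  (/-distribʳ-+ (f zero * g zero) (ℕΣ.sum (λ i → f (suc i) * g (suc i))) d)

-- The expected value

expectedMaxEffectiveRow≤ : ∀ n k .{{_ : NonZero n}} →
                           expectedMaxEffectiveRow n k ≤ 1ℚ + (+ (2 * k)) / n
expectedMaxEffectiveRow≤ n k = begin
  expectedMaxEffectiveRow n k
    -- All probabilities share the denominator `length Ω`, so the expectation is a single fraction.
    ≡⟨ ∑-/ {n} (suc ∘ toℕ) (λ i → length (filter (λ G → maxEffectiveRow G ℕ.≟ suc (toℕ i)) Ω)) (length Ω) ⟩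
  + R / length Ω
    ≤⟨ /-mono-≤-× R (length Ω) (n ℕ.+ 2 * k) n Rn≤ ⟩
  + (n ℕ.+ 2 * k) / n
    ≡⟨ /-distribʳ-+ n (2 * k) n ⟨
  + n / n + + (2 * k) / n
    ≡⟨ cong (_+ + (2 * k) / n) (n/n≡1 n) ⟩
  1ℚ + + (2 * k) / n ∎
  where
  open ℚ.≤-Reasoning
  Ω = sampleSpace n k
  instance
    Ω≢0 : NonZero (length Ω)
    Ω≢0 = sampleSpace-nonZero n k

  R : ℕ
  R = ℕΣ.sum {n} (λ i → suc (toℕ i) * length (filter (λ G → maxEffectiveRow G ℕ.≟ suc (toℕ i)) Ω))

  Rn≤ : R * n ℕ.≤ (n ℕ.+ 2 * k) * length Ω
  Rn≤ = ℕ.≤-trans (ℕ.≤-reflexive (ℕ.*-comm R n)) (ℕ.≤-trans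
    (ℕ.*-monoʳ-≤ n (∑-fibres≤ {n = n} (suc ∘ toℕ) (Fin.toℕ-injective ∘ ℕ.suc-injective) maxEffectiveRow Ω))
    (sum-maxEffectiveRow≤ n k))

theorem5 : (n k : ℕ) .{{_ : NonZero n}} →
    (expectedMaxEffectiveRow n k ≤ 1ℚ + (+ (2 ℕ.* k)) / n) ×
    (2 ℕ.* k ℕ.≤ n → expectedMaxEffectiveRow n k ≤ (+ 2) / 1)
theorem5 n k = expectedMaxEffectiveRow≤ n k , λ 2k≤n →
  ℚ.≤-trans (expectedMaxEffectiveRow≤ n k)
    -- The hypothesis gives 2k/n ≤ 1/1, and `1ℚ` plus 1/1 computes to 2/1.
    (ℚ.+-monoʳ-≤ 1ℚ (/-mono-≤-× (2 * k) n 1 1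
      (subst₂ ℕ._≤_ (sym (ℕ.*-identityʳ (2 * k))) (sym (ℕ.*-identityˡ n)) 2k≤n)))
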